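{- Let $\mathcal{G}=(\mathcal{N},\mathcal{A},\mathcal{R})$ be a normed BPA system, and let $M_{rhs}=\max\{\|\alpha\| : \text{there is a rule } A\xrightarrow{a}\alpha \text{ in } \mathcal{R}\}$. For all $\alpha_1,\alpha_2\in\mathcal{N}^*$, if $\alpha_1\not\sim\alpha_2$ then $$\mathrm{eqlevel}(\alpha_1,\alpha_2)\leq \min\{\|\alpha_1\|,\|\alpha_2\|\}+|\mathcal{N}|^2\cdot M_{rhs}.$$
   Context: A BPA system is a tuple $\mathcal{G}=(\mathcal{N},\mathcal{A},\mathcal{R})$ of finite nonempty sets of nonterminals $\mathcal{N}$, actions $\mathcal{A}$, and rules $\mathcal{R}$, each rule being of the form $A\xrightarrow{a}\alpha$ with $A\in\mathcal{N}$, $a\in\mathcal{A}$, $\alpha\in\mathcal{N}^*$. It is assumed that each $A\in\mathcal{N}$ has at least one rule $A\xrightarrow{a}\alpha$ in $\mathcal{R}$. The associated labelled transition system has here the state set $\mathcal{N}^*$ (finite strings only) and the transitions $A\beta\xrightarrow{a}\alpha\beta$ for each rule $A\xrightarrow{a}\alpha$ in $\mathcal{R}$ and each $\beta\in\mathcal{N}^*$; the relations are extended to $\xrightarrow{w}$ for $w\in\mathcal{A}^*$ in the usual way. The norm $\|\alpha\|$ of a state $\alpha$ is the length of a shortest $w\in\mathcal{A}^*$ with $\alpha\xrightarrow{w}\varepsilon$ ($\varepsilon$ is the empty word), and $\|\alpha\|=\omega$ if there is no such $w$. The BPA system is normed if $\|A\|<\omega$ for all $A\in\mathcal{N}$. A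 set $\mathcal{B}$ of pairs of states covers $(\alpha,\beta)$ if for each $\alpha\xrightarrow{a}\alpha'$ there is $\beta\xrightarrow{a}\beta'$ with $(\alpha',\beta')\in\mathcal{B}$, and for each $\beta\xrightarrow{a}\beta'$ there is $\alpha\xrightarrow{a}\alpha'$ with $(\alpha',\beta')\in\mathcal{B}$. Bisimilarity $\sim$ is the union of all sets $\mathcal{B}$ that cover each of their own elements. Let $\sim_0$ be the set of all pairs of states, and let $\sim_{i+1}$ be the set of all pairs covered by $\sim_i$. The equivalence level is $\mathrm{eqlevel}(\alpha,\beta)=k\in\mathbb{N}$ if $\alpha\sim_k\beta$ and $\alpha\not\sim_{k+1}\beta$, and $\mathrm{eqlevel}(\alpha,\beta)=\omega$ if $\alpha\sim\beta$. -}

module Defs where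

open import Data.Fin using (Fin)
open import Data.List using (List; []; _∷_; _++_; length)
open import Data.List.Membership.Propositional using (_∈_)
open import Data.Nat using (ℕ; zero; suc; _≤_; NonZero)
open import Data.Product using (_×_; _,_; ∃-syntax; Σ-syntax)
open import Data.Unit using (⊤)
open import Level using (0ℓ) renaming (suc to lsuc)
open import Relation.Binary.Core using (Rel)
open import Relation.Nullary using (¬_)
open import Relation.Nullary.Construct.Add.Supremum using (_⁺; [_]; ⊤⁺)

-- ℕ ∪ {ω}: the value ω is ⊤⁺, and [ k ] is the finite value k.
open import Relation.Binary.Construct.Add.Supremum.NonStrict _≤_
  using (_≤⁺_) public

ℕω : Set
ℕω = ℕ ⁺

-- The finite nonempty sets of nonterminals and actions are Fin #N and
-- Fin #A.  The finite set of rules is given by a list, of which only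
-- membership is ever used; it is nonempty by N-nonempty and has-rule.
record BPA : Set where
  field
    #N #A      : ℕ
    N-nonempty : NonZero #N
    A-nonempty : NonZero #A

  Nonterminal : Set
  Nonterminal = Fin #N

  Action : Set
  Action = Fin #A

  State : Set
  State = List Nonterminal

  Word : Set
  Word = List Action

  field
    rules    : List (Nonterminal × Action × State)
    has-rule : ∀ A → ∃[ a ] ∃[ α ] (A , a , α) ∈ rules

module _ (G : BPA) where
  open BPA G

  data Step : State → Action → State → Set where
    step : ∀ {A a α} → (A , a , α) ∈ rules →
           ∀ β → Step (A ∷ β) a (α ++ β)

  data Steps : State → Word → State → Set where
    done : ∀ {α} → Steps α [] α
    _then_ : ∀ {α β γ a w} → Step α a β → Steps β w γ → Steps α (a ∷ w) γ

  -- Norm α e says that ‖α‖ = e.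
  data Norm (α : State) : ℕω → Set where
    finite   : ∀ {w} → Steps α w [] →
               (∀ v → Steps α v [] → length w ≤ length v) →
               Norm α [ length w ]
    infinite : (∀ w → ¬ Steps α w []) → Norm α ⊤⁺

  Normed : Set
  Normed = ∀ (A : Nonterminal) → ∃[ k ] Norm (A ∷ []) [ k ]

  -- IsMrhs m says that m is the maximum of the norms of right-hand sides.
  IsMrhs : ℕω → Set
  IsMrhs m =
    (∃[ A ] ∃[ a ] ∃[ α ] (A , a , α) ∈ rules × Norm α m) ×
    (∀ A a α e → (A , a , α) ∈ rules → Norm α e → e ≤⁺ m)

  Covers : ∀ {ℓ} → Rel State ℓ → Rel State ℓ
  Covers B α β =
    (∀ a α′ → Step α a α′ → ∃[ β′ ] Step β a β′ × B α′ β′) ×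
    (∀ a β′ → Step β a β′ → ∃[ α′ ] Step α a α′ × B α′ β′)

  Bisimulation : Rel State 0ℓ → Set
  Bisimulation B = ∀ α β → B α β → Covers B α β

  Bisimilar : Rel State (lsuc 0ℓ)
  Bisimilar α β = Σ[ B ∈ Rel State 0ℓ ] Bisimulation B × B α β

  BisimilarUpTo : ℕ → Rel State 0ℓ
  BisimilarUpTo zero    _ _ = ⊤
  BisimilarUpTo (suc i)     = Covers (BisimilarUpTo i)

  -- EqLevel α β e says that eqlevel(α,β) = e.
  data EqLevel (α β : State) : ℕω → Set₁ where
    finite   : ∀ {k} → BisimilarUpTo k α β → ¬ BisimilarUpTo (suc k) α β →
               EqLevel α β [ k ]
    infinite : Bisimilar α β → EqLevel α β ⊤⁺

{-# OPTIONS --safe #-}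
-- Consider (A α, B β) with finite level e above the common norm and ‖A‖ ≤ ‖B‖.
-- Answering a shortest word A → ε gives B → γ with α ∼_{e-‖A‖} γ β. If this
-- level is exact, recurse on (α, γ β), which has smaller norm. Otherwise e is
-- the level of (A γ β, B β), so e ≤ f + ‖β‖ where f is the level of (A γ, B).
-- One step from (A γ, B) leads to a pair of level f - 1 in which one side is a
-- right-hand side, of norm at most M_rhs. As the level is now below f, the
-- relation B ∼_f A γ can be used as an equality whenever A and B are at the
-- heads again: it reduces such a pair to one of smaller norm. Hence the cost
-- M_rhs is paid at most once for each of the |N|² pairs (A, B).
module Submission where

open import Defs
open import Data.Empty using (⊥-elim)
open import Data.Fin.Properties using () renaming (_≟_ to _≟F_)
open import Data.List using (List; []; _∷_; _++_; length; map; filter; allFin; cartesianProduct)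
open import Data.List.Properties using (++-assoc; ++-identityʳ; length-++; length-map; length-tabulate)
open import Data.List.Membership.Propositional using (_∈_; find; lose)
open import Data.List.Membership.Propositional.Properties
  using (∈-map⁺; ∈-map⁻; ∈-filter⁺; ∈-filter⁻; ∈-cartesianProduct⁺; ∈-allFin)
open import Data.List.Relation.Unary.All using (All; all?) renaming (lookup to All-lookup; tabulate to All-tabulate)
open import Data.List.Relation.Unary.Any using (Any; here; there; any?)
open import Data.Nat using (ℕ; zero; suc; _+_; _*_; _^_; _⊓_; _≤_; _<_; z≤n; s≤s; s≤s⁻¹)
open import Data.Nat.Properties
open import Data.Product using (_×_; _,_; ∃-syntax; proj₁; proj₂)
open import Data.Sum as Sum using (_⊎_; inj₁; inj₂)
open import Data.Unit using (tt)
open import Function using (id; flip)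
open import Level using (0ℓ)
open import Relation.Binary.Core using (Rel)
open import Relation.Binary.Definitions using (Decidable)
open import Relation.Binary.Construct.Add.Supremum.NonStrict _≤_ using ([_])
open import Relation.Binary.PropositionalEquality
  using (_≡_; refl; sym; trans; cong; cong₂; subst)
open import Relation.Nullary using (¬_; yes; no)
open import Relation.Nullary.Construct.Add.Supremum using ([_])
open import Relation.Nullary.Decidable using (_×-dec_; decidable-stable; map′)

-- Counting in lists.

length-cartesianProduct : ∀ {a b} {X : Set a} {Y : Set b} (xs : List X) (ys : List Y) →
                          length (cartesianProduct xs ys) ≡ length xs * length ys
length-cartesianProduct []       ys = refl
length-cartesianProduct (x ∷ xs) ys = trans (length-++ (map (x ,_) ys))
  (cong₂ _+_ (length-map (x ,_) ys) (length-cartesianProduct xs ys))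

-- Exactly one occurrence is dropped, so further copies of `x` may survive in `ys`. The exact length
-- is what drives the recursion of `level-bound`.
∈-remove : ∀ {a} {X : Set a} {x : X} {xs : List X} → x ∈ xs →
           ∃[ ys ] length xs ≡ suc (length ys) × (∀ {y} → y ∈ xs → y ≡ x ⊎ y ∈ ys)
∈-remove {xs = x ∷ xs} (here refl) = xs , refl , λ where
  (here eq) → inj₁ eq
  (there i) → inj₂ i
∈-remove {xs = x ∷ xs} (there i) with ∈-remove i
... | ys , eq , split = x ∷ ys , cong suc eq , λ where
  (here eq) → inj₂ (here eq)
  (there j) → Sum.map id there (split j)

module _ (G : BPA) where
  open BPA G

  -- The approximants of bisimilarity.

  infix 4 _∼[_]_
  _∼[_]_ : State → ℕ → State → Set
  α ∼[ k ] β = BisimilarUpTo G k α β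

  ∼-refl : ∀ k α → α ∼[ k ] α
  ∼-refl zero    α = tt
  ∼-refl (suc k) α = (λ a α′ s → α′ , s , ∼-refl k α′) , (λ a α′ s → α′ , s , ∼-refl k α′)

  ∼-sym : ∀ k α β → α ∼[ k ] β → β ∼[ k ] α
  ∼-sym zero    α β _       = tt
  ∼-sym (suc k) α β (f , g) =
    (λ a β′ s → let α′ , t , r = g a β′ s in α′ , t , ∼-sym k α′ β′ r) ,
    (λ a α′ s → let β′ , t , r = f a α′ s in β′ , t , ∼-sym k α′ β′ r)

  ∼-trans : ∀ k α β γ → α ∼[ k ] β → β ∼[ k ] γ → α ∼[ k ] γ
  ∼-trans zero    α β γ _ _ = tt
  ∼-trans (suc k) α β γ (f , g) (f′ , g′) =
    (λ a α₁ s → let β₁ , t , r = f a α₁ s ; γ₁ , u , q = f′ a β₁ t in γ₁ , u , ∼-trans k α₁ β₁ γ₁ r q) ,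
    (λ a γ₁ s → let β₁ , t , r = g′ a γ₁ s ; α₁ , u , q = g a β₁ t in α₁ , u , ∼-trans k α₁ β₁ γ₁ q r)

  ∼-mono : ∀ {j k} α β → j ≤ k → α ∼[ k ] β → α ∼[ j ] β
  ∼-mono α β z≤n     _       = tt
  ∼-mono α β (s≤s p) (f , g) =
    (λ a α₁ s → let β₁ , t , r = f a α₁ s in β₁ , t , ∼-mono α₁ β₁ p r) ,
    (λ a β₁ s → let α₁ , t , r = g a β₁ s in α₁ , t , ∼-mono α₁ β₁ p r)

  -- By `has-rule` only the empty state is stuck, and one level suffices to see this.
  ε∼⇒ε : ∀ k β → [] ∼[ suc k ] β → β ≡ []
  ε∼⇒ε k []      _       = refl
  ε∼⇒ε k (B ∷ β) (_ , g) with has-rule B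
  ... | a , ρ , i with g a (ρ ++ β) (step i β)
  ... | _ , () , _

  -- Decidability of the approximants.

  successors : State → List (Action × State)
  successors []      = []
  successors (A ∷ β) = map (λ (_ , a , α) → a , α ++ β) (filter (λ r → proj₁ r ≟F A) rules)

  Step⇒∈ : ∀ {α a β} → Step G α a β → (a , β) ∈ successors α
  Step⇒∈ (step i β) = ∈-map⁺ _ (∈-filter⁺ _ i refl)

  ∈⇒Step : ∀ α {a β} → (a , β) ∈ successors α → Step G α a β
  ∈⇒Step (A ∷ α) i with ∈-map⁻ _ i
  ... | r , j , refl with ∈-filter⁻ (λ r → proj₁ r ≟F A) {xs = rules} j
  ... | k , refl = step k α

  Simulates : Rel State 0ℓ → Rel State 0ℓ
  Simulates B α β = ∀ a α′ → Step G α a α′ → ∃[ β′ ] Step G β a β′ × B α′ β′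

  simulates? : ∀ {B} → Decidable B → Decidable (Simulates B)
  simulates? {B} B? α β = map′ to from
    (all? (λ p → any? (matches? p) (successors β)) (successors α))
    where
    Matches : Rel (Action × State) 0ℓ
    Matches (a , α′) (b , β′) = a ≡ b × B α′ β′
    matches? : Decidable Matches
    matches? (a , α′) (b , β′) = (a ≟F b) ×-dec B? α′ β′
    to : All (λ p → Any (Matches p) (successors β)) (successors α) → Simulates B α β
    to p a α′ s with find (All-lookup p (Step⇒∈ s))
    ... | (_ , β′) , j , refl , r = β′ , ∈⇒Step β j , r
    from : Simulates B α β → All (λ p → Any (Matches p) (successors β)) (successors α)
    from f = All-tabulate λ {p} i →
      let β′ , t , r = f (proj₁ p) (proj₂ p) (∈⇒Step α i) in lose (Step⇒∈ t) (refl , r)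

  -- Branching is finite, so both quantifiers of `Covers` range over finite lists. This makes the
  -- later case distinctions and arguments by contradiction constructive.
  ∼-dec : ∀ k → Decidable (_∼[ k ]_)
  ∼-dec zero    α β = yes tt
  ∼-dec (suc k) α β = simulates? (∼-dec k) α β ×-dec
    simulates? (flip (∼-dec k)) β α

  Step-++ : ∀ {α a β} γ → Step G α a β → Step G (α ++ γ) a (β ++ γ)
  Step-++ γ (step {A} {a} {α} i β) =
    subst (Step G _ a) (sym (++-assoc α β γ)) (step i (β ++ γ))

  Step-∷-++ : ∀ {A} α {γ a η} → Step G (A ∷ α ++ γ) a η →
              ∃[ β ] Step G (A ∷ α) a β × η ≡ β ++ γ
  Step-∷-++ α {γ} (step {α = ρ} i _) = ρ ++ α , step i α , sym (++-assoc ρ α γ)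

  -- While levels remain, the prefixes run out only together, by `ε∼⇒ε`. Until then they answer each
  -- other's steps, and afterwards both sides are `γ`.
  ∼-++ʳ : ∀ k α β γ → α ∼[ k ] β → α ++ γ ∼[ k ] β ++ γ
  ∼-++ʳ zero    α       β       γ _ = tt
  ∼-++ʳ (suc k) []      β       γ h with refl ← ε∼⇒ε k β h = ∼-refl (suc k) γ
  ∼-++ʳ (suc k) (A ∷ α) []      γ h with () ← ε∼⇒ε k (A ∷ α) (∼-sym (suc k) (A ∷ α) [] h)
  ∼-++ʳ (suc k) (A ∷ α) (B ∷ β) γ (f , g) = to , from
    where
    to : Simulates (_∼[ k ]_) (A ∷ α ++ γ) (B ∷ β ++ γ)
    to a _ s with Step-∷-++ α s
    ... | α₁ , s₁ , refl with f a α₁ s₁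
    ... | β₁ , t , r = β₁ ++ γ , Step-++ γ t , ∼-++ʳ k α₁ β₁ γ r
    from : Simulates (flip _∼[ k ]_) (B ∷ β ++ γ) (A ∷ α ++ γ)
    from a _ s with Step-∷-++ β s
    ... | β₁ , s₁ , refl with g a β₁ s₁
    ... | α₁ , t , r = α₁ ++ γ , Step-++ γ t , ∼-++ʳ k α₁ β₁ γ r

  follow : ∀ k {α w α′} β → Steps G α w α′ → α ∼[ length w + k ] β →
           ∃[ β′ ] Steps G β w β′ × α′ ∼[ k ] β′
  follow k β done h = β , done , h
  follow k β (s then ss) (f , _) with f _ _ s
  ... | β₁ , t , r with follow k β₁ ss r
  ... | β₂ , ts , q = β₂ , t then ts , q

  Steps-++ : ∀ {α w α′} γ → Steps G α w α′ → Steps G (α ++ γ) w (α′ ++ γ)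
  Steps-++ γ done        = done
  Steps-++ γ (s then ss) = Step-++ γ s then Steps-++ γ ss

  Steps-trans : ∀ {α v β w γ} → Steps G α v β → Steps G β w γ → Steps G α (v ++ w) γ
  Steps-trans done        ts = ts
  Steps-trans (s then ss) ts = s then Steps-trans ss ts

  Norm-word : ∀ {α n} → Norm G α [ n ] → ∃[ w ] Steps G α w [] × length w ≡ n
  Norm-word (finite {w} s _) = w , s , refl

  Norm-minimal : ∀ {α n} → Norm G α [ n ] → ∀ {v} → Steps G α v [] → n ≤ length v
  Norm-minimal (finite _ m) {v} s = m v s

  -- Finite equivalence levels.

  Level : ℕ → Rel State 0ℓ
  Level e α β = α ∼[ e ] β × ¬ α ∼[ suc e ] β

  Level-sym : ∀ e α β → Level e α β → Level e β α
  Level-sym e α β (p , q) = ∼-sym e α β p , λ h → q (∼-sym (suc e) β α h)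

  find-level : ∀ m α β → ¬ α ∼[ m ] β → ∃[ e ] e < m × Level e α β
  find-level zero    α β h = ⊥-elim (h tt)
  find-level (suc m) α β h with ∼-dec m α β
  ... | yes p = m , ≤-refl , p , h
  ... | no ¬p with find-level m α β ¬p
  ... | e , e<m , l = e , m≤n⇒m≤1+n e<m , l

  -- If `e` exceeded `K`, no pair of matching successors could have level exactly `e`. Every answer
  -- would then be valid one level higher, against the level `suc e` of the pair itself.
  Level-predecessor-bound : ∀ {e K} α β → Level (suc e) α β →
    (∀ {a α′ β′} → Step G α a α′ → Step G β a β′ → Level e α′ β′ → e ≤ K) → e ≤ K
  Level-predecessor-bound {e} {K} α β ((f , g) , ¬h) bound =
    decidable-stable (e ≤? K) λ e≰K →
      let raise : ∀ {a α′ β′} → Step G α a α′ → Step G β a β′ → α′ ∼[ e ] β′ → α′ ∼[ suc e ] β′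
          raise s t r = decidable-stable (∼-dec (suc e) _ _) λ ¬r → e≰K (bound s t (r , ¬r))
      in ¬h ((λ a α′ s → let β′ , t , r = f a α′ s in β′ , t , raise s t r) ,
             (λ a β′ t → let α′ , s , r = g a β′ t in α′ , s , raise s t r))

  module _ (normed : Normed G) where

    -- Norms.

    norm₁ : Nonterminal → ℕ
    norm₁ A = proj₁ (normed A)

    norm : State → ℕ
    norm []      = 0
    norm (A ∷ α) = norm₁ A + norm α

    norm-++ : ∀ α β → norm (α ++ β) ≡ norm α + norm β
    norm-++ []      β = refl
    norm-++ (A ∷ α) β = trans (cong (norm₁ A +_) (norm-++ α β)) (sym (+-assoc (norm₁ A) _ _))

    norm-word : ∀ α → ∃[ w ] Steps G α w [] × length w ≡ norm α
    norm-word []      = [] , done , refl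
    norm-word (A ∷ α) with Norm-word (proj₂ (normed A)) | norm-word α
    ... | v , s , eq | w , t , eq′ =
      v ++ w , Steps-trans (Steps-++ α s) t , trans (length-++ v) (cong₂ _+_ eq eq′)

    -- The step followed by a shortest word for the right-hand side empties `A`, so its length is at
    -- least `norm₁ A`.
    norm-step : ∀ {α a β} → Step G α a β → norm α ≤ suc (norm β)
    norm-step {a = a} (step {A} {α = ρ} i β) with norm-word ρ
    ... | w , s , eq = begin
      norm₁ A + norm β          ≤⟨ +-monoˡ-≤ (norm β) (Norm-minimal (proj₂ (normed A)) (A→ρ then s)) ⟩
      suc (length w) + norm β   ≡⟨ cong (λ l → suc l + norm β) eq ⟩
      suc (norm ρ + norm β)     ≡⟨ cong suc (norm-++ ρ β) ⟨
      suc (norm (ρ ++ β))       ∎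
      where
      open ≤-Reasoning
      A→ρ : Step G (A ∷ []) a ρ
      A→ρ = subst (Step G (A ∷ []) a) (++-identityʳ ρ) (step i [])

    norm-minimal : ∀ {α w} → Steps G α w [] → norm α ≤ length w
    norm-minimal done        = z≤n
    norm-minimal (s then ss) = ≤-trans (norm-step s) (s≤s (norm-minimal ss))

    Norm⇒norm : ∀ {α n} → Norm G α [ n ] → n ≡ norm α
    Norm⇒norm {α} N with Norm-word N | norm-word α
    ... | v , s , refl | w , t , eq =
      ≤-antisym (≤-trans (Norm-minimal N t) (≤-reflexive eq)) (norm-minimal s)

    norm₁-positive : ∀ A → 1 ≤ norm₁ A
    norm₁-positive A with Norm-word (proj₂ (normed A))
    ... | _ ∷ _ , _ , eq = subst (1 ≤_) eq (s≤s z≤n)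

    norm≡0⇒ε : ∀ α → norm α ≡ 0 → α ≡ []
    norm≡0⇒ε []      _  = refl
    norm≡0⇒ε (A ∷ α) eq =
      ⊥-elim (<⇒≢ (≤-trans (norm₁-positive A) (m≤m+n _ (norm α))) (sym eq))

    -- `β` answers a shortest word emptying `α`. Since `norm α < k`, a level is left at the end, and
    -- it forces the answer to end in the empty state too.
    ∼⇒norm-≥ : ∀ k α β → α ∼[ k ] β → norm α < k → norm β ≤ norm α
    ∼⇒norm-≥ k α β h n<k with norm-word α
    ... | w , ss , eq with m≤n⇒∃[o]m+o≡n (subst (_< k) (sym eq) n<k)
    ... | o , refl with follow (suc o) β ss (subst (α ∼[_] β) (sym (+-suc (length w) o)) h)
    ... | β′ , ts , r with refl ← ε∼⇒ε o β′ r = subst (norm β ≤_) eq (norm-minimal ts)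

    ∼⇒norm-≡ : ∀ k α β → α ∼[ k ] β → norm α < k → norm α ≡ norm β
    ∼⇒norm-≡ k α β h n<k = ≤-antisym (∼⇒norm-≥ k β α (∼-sym k α β h) (≤-<-trans p n<k)) p
      where p = ∼⇒norm-≥ k α β h n<k

    -- Reaching the tails takes at least norm δ steps, so only then can they be told apart.
    ∼-++ˡ : ∀ j k δ α β → j ≤ norm δ + k → α ∼[ k ] β → δ ++ α ∼[ j ] δ ++ β
    ∼-++ˡ zero    k δ       α β _ _ = tt
    ∼-++ˡ (suc j) k []      α β p h = ∼-mono α β p h
    ∼-++ˡ (suc j) k (A ∷ δ) α β p h = to , from
      where
      later : ∀ {a δ₁} → Step G (A ∷ δ) a δ₁ → δ₁ ++ α ∼[ j ] δ₁ ++ β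
      later {δ₁ = δ₁} s = ∼-++ˡ j k δ₁ α β (s≤s⁻¹ (≤-trans p (+-monoˡ-≤ k (norm-step s)))) h
      to : Simulates (_∼[ j ]_) (A ∷ δ ++ α) (A ∷ δ ++ β)
      to a _ s with Step-∷-++ δ s
      ... | δ₁ , s₁ , refl = δ₁ ++ β , Step-++ β s₁ , later s₁
      from : Simulates (flip _∼[ j ]_) (A ∷ δ ++ β) (A ∷ δ ++ α)
      from a _ s with Step-∷-++ δ s
      ... | δ₁ , s₁ , refl = δ₁ ++ α , Step-++ α s₁ , later s₁

    ∼-∷ : ∀ k A α β → α ∼[ k ] β → A ∷ α ∼[ norm₁ A + k ] A ∷ β
    ∼-∷ k A α β = ∼-++ˡ (norm₁ A + k) k (A ∷ []) α β (+-monoˡ-≤ k (m≤m+n (norm₁ A) 0))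

    -- Cancellation up to a level.

    ¬∼-++-absorb : ∀ k A α β → ¬ A ∷ α ++ β ∼[ suc k + norm β ] β
    ¬∼-++-absorb k A α β h = <⇒≢ longer
      (∼⇒norm-≡ (suc k + norm β) β (A ∷ α ++ β) (∼-sym (suc k + norm β) (A ∷ α ++ β) β h)
        (s≤s (m≤n+m (norm β) k)))
      where
      longer : norm β < norm (A ∷ α ++ β)
      longer = +-mono-≤ (norm₁-positive A)
        (≤-trans (m≤n+m (norm β) (norm α)) (≤-reflexive (sym (norm-++ α β))))

    -- If one prefix ran out first, `β` would be related above its own norm to a state of larger
    -- norm. The additional `norm β` levels serve to exclude this.
    ∼-cancel-++ʳ : ∀ k α α′ β → α ++ β ∼[ k + norm β ] α′ ++ β → α ∼[ k ] α′
    ∼-cancel-++ʳ zero    α       α′       β h = tt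
    ∼-cancel-++ʳ (suc k) []      []       β h = ∼-refl (suc k) []
    ∼-cancel-++ʳ (suc k) []      (B ∷ α′) β h =
      ⊥-elim (¬∼-++-absorb k B α′ β (∼-sym (suc k + norm β) β (B ∷ α′ ++ β) h))
    ∼-cancel-++ʳ (suc k) (A ∷ α) []       β h = ⊥-elim (¬∼-++-absorb k A α β h)
    ∼-cancel-++ʳ (suc k) (A ∷ α) (B ∷ α′) β (f , g) = to , from
      where
      to : Simulates (_∼[ k ]_) (A ∷ α) (B ∷ α′)
      to a α₁ s with f a (α₁ ++ β) (Step-++ β s)
      ... | _ , t , r with Step-∷-++ α′ t
      ... | α₂ , t₂ , refl = α₂ , t₂ , ∼-cancel-++ʳ k α₁ α₂ β r
      from : Simulates (flip _∼[ k ]_) (B ∷ α′) (A ∷ α)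
      from a α₁ s with g a (α₁ ++ β) (Step-++ β s)
      ... | _ , t , r with Step-∷-++ α t
      ... | α₂ , t₂ , refl = α₂ , t₂ , ∼-cancel-++ʳ k α₂ α₁ β r

    -- Each step lowers the norm by at most one, so a word this short cannot reach into `β`.
    Steps-split : ∀ δ β {w η} → Steps G (δ ++ β) w η → length w ≤ norm δ →
                  ∃[ δ′ ] Steps G δ w δ′ × η ≡ δ′ ++ β
    Steps-split δ       β done        p = δ , done , refl
    Steps-split []      β (s then ss) ()
    Steps-split (A ∷ δ) β (s then ss) p with Step-∷-++ δ s
    ... | δ₁ , s₁ , refl with Steps-split δ₁ β ss (s≤s⁻¹ (≤-trans p (norm-step s₁)))
    ... | δ₂ , ss₂ , eq = δ₂ , s₁ then ss₂ , eq

    pop : ∀ k A B α β → norm₁ A ≤ norm₁ B → A ∷ α ∼[ norm₁ A + k ] B ∷ β →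
          ∃[ γ ] α ∼[ k ] γ ++ β
    pop k A B α β A≤B h with Norm-word (proj₂ (normed A))
    ... | w , ss , eq
      with follow k (B ∷ β) (Steps-++ α ss) (subst (λ l → A ∷ α ∼[ l + k ] B ∷ β) (sym eq) h)
    ... | η , ts , r
      with Steps-split (B ∷ []) β ts
             (≤-trans (≤-reflexive eq) (≤-trans A≤B (m≤m+n (norm₁ B) 0)))
    ... | γ , _ , refl = γ , r

    -- Popping `A` on both sides may leave a remainder `γ` on the right. As `norm α < k`, norms are
    -- preserved, so `γ` has norm zero and is empty.
    ∼-cancel-∷ : ∀ k A α β → norm α < k → norm α ≡ norm β →
                 A ∷ α ∼[ norm₁ A + k ] A ∷ β → α ∼[ k ] β
    ∼-cancel-∷ k A α β α<k α≡β h with pop k A A α β ≤-refl h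
    ... | γ , r = subst (λ δ → α ∼[ k ] δ ++ β) (norm≡0⇒ε γ γ≡0) r
      where
      γ≡0 : norm γ ≡ 0
      γ≡0 = +-cancelʳ-≡ (norm β) (norm γ) 0
        (trans (sym (norm-++ γ β)) (trans (sym (∼⇒norm-≡ k α (γ ++ β) r α<k)) α≡β))

    ∼-∷-trans : ∀ k A α β γ → α ∼[ suc k ] β → A ∷ β ∼[ suc (norm₁ A + k) ] γ →
           A ∷ α ∼[ suc (norm₁ A + k) ] γ
    ∼-∷-trans k A α β γ p = ∼-trans (suc (norm₁ A + k)) (A ∷ α) (A ∷ β) γ
      (subst (A ∷ α ∼[_] A ∷ β) (+-suc (norm₁ A) k) (∼-∷ (suc k) A α β p))

    add-norm : ∀ {k K} A α → k ≤ norm α + K → norm₁ A + k ≤ norm (A ∷ α) + K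
    add-norm {K = K} A α p = ≤-trans (+-monoʳ-≤ (norm₁ A) p)
      (≤-reflexive (sym (+-assoc (norm₁ A) (norm α) K)))

    tail< : ∀ {n} A α → norm (A ∷ α) < suc n → norm α < n
    tail< A α p = ≤-trans (+-monoˡ-≤ (norm α) (norm₁-positive A)) (s≤s⁻¹ p)

    -- Bounds on levels below a threshold.

    LevelsBelow : ℕ → ℕ → Set
    LevelsBelow c K = ∀ e α β → e < c → Level e α β → e ≤ norm α + K

    module _ (Mrhs : ℕ) (isMrhs : IsMrhs G [ Mrhs ]) where

      norm-rhs : ∀ {A a α} → (A , a , α) ∈ rules → norm α ≤ Mrhs
      norm-rhs {A} {a} {α} i with norm-word α
      ... | w , ss , eq with proj₂ isMrhs A a α [ length w ] i (finite ss λ v ts →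
              ≤-trans (≤-reflexive eq) (norm-minimal ts))
      ... | [ p ] = subst (_≤ Mrhs) eq p

      -- Below level c, (A ∷ α , B ∷ β) reduces to (α , γ ++ β), whose level is lower by norm₁ A.
      known-pair : ∀ {c K e} A B α β γ → B ∷ [] ∼[ c ] A ∷ γ → e < c →
        norm (A ∷ α) < e → Level e (A ∷ α) (B ∷ β) →
        (∀ k η → k < c → Level k α η → k ≤ norm α + K) → e ≤ norm (A ∷ α) + K
      known-pair {c} {K} A B α β γ B∼Aγ e<c n<e (h , ¬h) tail-bound
        with m≤n⇒∃[o]m+o≡n (≤-trans (m≤m+n (norm₁ A) (norm α)) (<⇒≤ n<e))
      ... | k , refl = add-norm A α (tail-bound k (γ ++ β) (≤-<-trans (m≤n+m k (norm₁ A)) e<c)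
        ( ∼-cancel-∷ k A α (γ ++ β) (+-cancelˡ-< (norm₁ A) (norm α) k n<e)
            (+-cancelˡ-≡ (norm₁ A) (norm α) (norm (γ ++ β))
              (∼⇒norm-≡ e (A ∷ α) (A ∷ γ ++ β) Aα∼Aγβ n<e))
            Aα∼Aγβ
        -- The strict `e < c` is essential: the relation of the heads must hold even at level
        -- `suc e` to carry `r` back to the original pair.
        , λ r → ¬h (∼-∷-trans k A α (γ ++ β) (B ∷ β) r
            (∼-mono (A ∷ γ ++ β) (B ∷ β) e<c (∼-sym c (B ∷ β) (A ∷ γ ++ β) Bβ∼Aγβ)))))
        where
        e = norm₁ A + k
        Bβ∼Aγβ : B ∷ β ∼[ c ] A ∷ γ ++ β
        Bβ∼Aγβ = ∼-++ʳ c (B ∷ []) (A ∷ γ) β B∼Aγ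
        Aα∼Aγβ : A ∷ α ∼[ e ] A ∷ γ ++ β
        Aα∼Aγβ = ∼-trans e (A ∷ α) (B ∷ β) (A ∷ γ ++ β) h
          (∼-mono (B ∷ β) (A ∷ γ ++ β) (<⇒≤ e<c) Bβ∼Aγβ)

      single-bound : ∀ {K} f B η → Level f (B ∷ []) η →
        LevelsBelow f K → f ≤ norm₁ B + (Mrhs + K)
      single-bound zero    B η l below = z≤n
      -- The step itself costs one, paid by `norm₁ B`, which is at least one.
      single-bound {K} (suc g) B η l below = +-mono-≤ (norm₁-positive B)
        (Level-predecessor-bound (B ∷ []) η l after-step)
        where
        after-step : ∀ {a α η′} → Step G (B ∷ []) a α → Step G η a η′ → Level g α η′ → g ≤ Mrhs + K
        after-step {η′ = η′} (step {α = ρ} i _) _ l′ = ≤-trans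
          (below g (ρ ++ []) η′ ≤-refl l′)
          (+-monoˡ-≤ K (≤-trans (≤-reflexive (cong norm (++-identityʳ ρ))) (norm-rhs i)))

      fresh-pair : ∀ {c K e} A B α β → norm₁ A ≤ norm₁ B → norm (A ∷ α) ≡ norm (B ∷ β) → e < c →
        norm (A ∷ α) < e → Level e (A ∷ α) (B ∷ β) →
        (∀ k η → k < c → Level k α η → k ≤ norm α + (Mrhs + K)) →
        (∀ f γ → f < c → B ∷ [] ∼[ f ] A ∷ γ → LevelsBelow f K) →
        e ≤ norm (A ∷ α) + (Mrhs + K)
      fresh-pair {c} {K} A B α β A≤B Aα≡Bβ e<c n<e (h , ¬h) tail-bound below
        with m≤n⇒∃[o]m+o≡n (≤-trans (m≤m+n (norm₁ A) (norm α)) (<⇒≤ n<e))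
      ... | k , refl with pop k A B α β A≤B h
      ... | γ , α∼γβ with ∼-dec (suc k) α (γ ++ β)
      ... | no ¬p = add-norm A α
        (tail-bound k (γ ++ β) (≤-<-trans (m≤n+m k (norm₁ A)) e<c) (α∼γβ , ¬p))
      -- Were `A ∷ γ` and `B ∷ []` still related at level `suc e`, appending `β` and using `p` would
      -- relate the original pair there.
      ... | yes p with find-level (suc (norm₁ A + k)) (A ∷ γ) (B ∷ []) (λ q →
              ¬h (∼-∷-trans k A α (γ ++ β) (B ∷ β) p
                   (∼-++ʳ (suc (norm₁ A + k)) (A ∷ γ) (B ∷ []) β q)))
      ... | f , f≤e , l@(_ , ¬q) = begin
        e                                     ≤⟨ e≤f+β ⟩
        f + norm β                            ≤⟨ +-monoˡ-≤ (norm β) f-bound ⟩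
        norm₁ B + (Mrhs + K) + norm β         ≡⟨ +-assoc (norm₁ B) (Mrhs + K) (norm β) ⟩
        norm₁ B + ((Mrhs + K) + norm β)       ≡⟨ cong (norm₁ B +_) (+-comm (Mrhs + K) (norm β)) ⟩
        norm₁ B + (norm β + (Mrhs + K))       ≡⟨ +-assoc (norm₁ B) (norm β) (Mrhs + K) ⟨
        norm (B ∷ β) + (Mrhs + K)             ≡⟨ cong (_+ (Mrhs + K)) Aα≡Bβ ⟨
        norm (A ∷ α) + (Mrhs + K)             ∎
        where
        open ≤-Reasoning
        e = norm₁ A + k
        l′ : Level f (B ∷ []) (A ∷ γ)
        l′ = Level-sym f (A ∷ γ) (B ∷ []) l
        f-bound : f ≤ norm₁ B + (Mrhs + K)
        f-bound = single-bound f B (A ∷ γ) l′ (below f γ (<-≤-trans f≤e e<c) (proj₁ l′))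
        Aγβ∼Bβ : A ∷ γ ++ β ∼[ e ] B ∷ β
        Aγβ∼Bβ = ∼-trans e (A ∷ γ ++ β) (A ∷ α) (B ∷ β)
          (∼-sym e (A ∷ α) (A ∷ γ ++ β) (∼-∷ k A α (γ ++ β) α∼γβ)) h
        e≤f+β : e ≤ f + norm β
        -- Otherwise enough levels remain to cancel `β` and relate `A ∷ γ` to `B ∷ []` at level
        -- `suc f`.
        e≤f+β = ≮⇒≥ λ f+β<e → ¬q (∼-cancel-++ʳ (suc f) (A ∷ γ) (B ∷ []) β
          (∼-mono (A ∷ γ ++ β) (B ∷ β) f+β<e Aγβ∼Bβ))

      -- R lists the pairs of heads for which the cost Mrhs may still have to be paid.
      Tabulated : List (Nonterminal × Nonterminal) → ℕ → Set
      Tabulated R c = ∀ A B → (A , B) ∈ R ⊎ ∃[ γ ] B ∷ [] ∼[ c ] A ∷ γ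

      -- The recursion is lexicographic: on the number `r` of unpaid pairs, then on the fuel `n`,
      -- which exceeds the left norm. Whenever a pair is paid, `r` drops and the fuel may be reset.
      level-bound : ∀ r R → length R ≡ r → ∀ c → Tabulated R c → LevelsBelow c (r * Mrhs)
      level-bound-fuel : ∀ r R → length R ≡ r → ∀ c → Tabulated R c →
        ∀ n e α β → norm α < n → e < c → Level e α β → e ≤ norm α + r * Mrhs
      level-bound-ordered : ∀ r R → length R ≡ r → ∀ c → Tabulated R c →
        ∀ n e A B α β → norm (A ∷ α) < suc n → e < c →
        norm₁ A ≤ norm₁ B → norm (A ∷ α) ≡ norm (B ∷ β) → norm (A ∷ α) < e →
        Level e (A ∷ α) (B ∷ β) → e ≤ norm (A ∷ α) + r * Mrhs

      level-bound r R eq c T e α β = level-bound-fuel r R eq c T (suc (norm α)) e α β ≤-refl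

      level-bound-fuel r R eq c T (suc n) e α β α<n e<c l with e ≤? norm α
      ... | yes e≤α = ≤-trans e≤α (m≤m+n (norm α) (r * Mrhs))
      ... | no e≰α with ∼⇒norm-≡ e α β (proj₁ l) (≰⇒> e≰α)
      level-bound-fuel r R eq c T (suc n) e [] β α<n e<c l | no e≰α | α≡β
        with refl ← norm≡0⇒ε β (sym α≡β) = ⊥-elim (proj₂ l (∼-refl (suc e) []))
      level-bound-fuel r R eq c T (suc n) e (A ∷ α) [] α<n e<c l | no e≰α | α≡β
        with () ← norm≡0⇒ε (A ∷ α) α≡β
      level-bound-fuel r R eq c T (suc n) e (A ∷ α) (B ∷ β) α<n e<c l | no e≰α | α≡β
        with ≤-total (norm₁ A) (norm₁ B)
      ... | inj₁ A≤B = level-bound-ordered r R eq c T n e A B α β α<n e<c A≤B α≡β (≰⇒> e≰α) l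
      ... | inj₂ B≤A = subst (λ m → e ≤ m + r * Mrhs) (sym α≡β)
        (level-bound-ordered r R eq c T n e B A β α (subst (_< suc n) α≡β α<n) e<c B≤A (sym α≡β)
          (subst (_< e) α≡β (≰⇒> e≰α)) (Level-sym e (A ∷ α) (B ∷ β) l))

      level-bound-ordered r R eq c T n e A B α β α<n e<c A≤B α≡β α<e l with T A B
      ... | inj₂ (γ , B∼Aγ) = known-pair A B α β γ B∼Aγ e<c α<e l λ k η →
        level-bound-fuel r R eq c T n k α η (tail< A α α<n)
      ... | inj₁ i with ∈-remove i
      level-bound-ordered zero R eq c T n e A B α β α<n e<c A≤B α≡β α<e l | inj₁ i | R′ , eq′ , _
        with () ← trans (sym eq) eq′
      level-bound-ordered (suc r) R eq c T n e A B α β α<n e<c A≤B α≡β α<e l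
        | inj₁ i | R′ , eq′ , split =
        fresh-pair A B α β A≤B α≡β e<c α<e l
          (λ k η → level-bound-fuel (suc r) R eq c T n k α η (tail< A α α<n))
          λ f γ f<c B∼Aγ → level-bound r R′ (suc-injective (trans (sym eq′) eq)) f
            (extend f<c γ B∼Aγ)
        where
        extend : ∀ {f} → f < c → ∀ γ → B ∷ [] ∼[ f ] A ∷ γ → Tabulated R′ f
        extend f<c γ B∼Aγ C D with T C D
        -- Relations recorded earlier survive the lowering of the threshold.
        ... | inj₂ (δ , D∼Cδ) = inj₂ (δ , ∼-mono (D ∷ []) (C ∷ δ) (<⇒≤ f<c) D∼Cδ)
        ... | inj₁ j with split j
        ... | inj₁ refl = inj₂ (γ , B∼Aγ)
        ... | inj₂ j′ = inj₁ j′

      -- The bound for all levels, and bisimilarity.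

      bound : ℕ
      bound = #N ^ 2 * Mrhs

      Level⇒≤ : ∀ e α β → Level e α β → e ≤ norm α + bound
      -- At the start every pair is unpaid and no relation is required, so any threshold above `e`
      -- is allowed.
      Level⇒≤ e α β = level-bound (#N ^ 2) (cartesianProduct (allFin #N) (allFin #N)) all-pairs
        (suc e) (λ A B → inj₁ (∈-cartesianProduct⁺ (∈-allFin A) (∈-allFin B))) e α β ≤-refl
        where
        all-pairs : length (cartesianProduct (allFin #N) (allFin #N)) ≡ #N ^ 2
        all-pairs = trans (length-cartesianProduct (allFin #N) (allFin #N))
          (cong₂ _*_ (length-tabulate {n = #N} id) (trans (length-tabulate {n = #N} id) (sym (*-identityʳ #N))))

      -- A failure at any `k` would give a finite level, which by `Level⇒≤` lies within the range
      -- that `h` already covers.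
      ∼-all : ∀ α β → α ∼[ suc (norm α + bound) ] β → ∀ k → α ∼[ k ] β
      ∼-all α β h k = decidable-stable (∼-dec k α β) λ ¬p →
        let e , _ , l = find-level k α β ¬p
        in proj₂ l (∼-mono α β (s≤s (Level⇒≤ e α β l)) h)

      -- A finite level of (α′ , β′) is bounded in terms of α′ alone, so one response serves all k.
      ∼-all-bisimulation : Bisimulation G (λ α β → ∀ k → α ∼[ k ] β)
      ∼-all-bisimulation α β h =
        (λ a α′ s →
          let m = suc (norm α′ + bound)
              β′ , t , r = proj₁ (h (suc m)) a α′ s
          in β′ , t , ∼-all α′ β′ r) ,
        (λ a β′ t →
          let m = suc (norm β′ + bound)
              α′ , s , r = proj₂ (h (suc m)) a β′ t
              all = ∼-all β′ α′ (∼-sym m α′ β′ r)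
          in α′ , s , λ k → ∼-sym k β′ α′ (all k))

theorem4p5 : (G : BPA) → Normed G →
    (Mrhs : ℕ) → IsMrhs G [ Mrhs ] →
    (α₁ α₂ : BPA.State G) → ¬ Bisimilar G α₁ α₂ →
    (n₁ n₂ : ℕ) → Norm G α₁ [ n₁ ] → Norm G α₂ [ n₂ ] →
    ∃[ e ] EqLevel G α₁ α₂ e × e ≤⁺ [ (n₁ ⊓ n₂) + BPA.#N G ^ 2 * Mrhs ]
theorem4p5 G normed Mrhs isMrhs α₁ α₂ ¬bis n₁ n₂ N₁ N₂
  with refl ← Norm⇒norm G normed N₁ | refl ← Norm⇒norm G normed N₂
  with find-level G (suc (n₁ + BPA.#N G ^ 2 * Mrhs)) α₁ α₂ (λ h → ¬bis
         (_ , ∼-all-bisimulation G normed Mrhs isMrhs , ∼-all G normed Mrhs isMrhs α₁ α₂ h))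
... | e , _ , l@(p , ¬p) = [ e ] , finite p ¬p ,
  -- Levels are symmetric, so the bound holds with either norm and hence with the minimum.
  [ subst (e ≤_) (sym (+-distribʳ-⊓ _ n₁ n₂))
      (⊓-glb (Level⇒≤ G normed Mrhs isMrhs e α₁ α₂ l)
             (Level⇒≤ G normed Mrhs isMrhs e α₂ α₁ (Level-sym G e α₁ α₂ l))) ]
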